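{- Let $G=(V,E)$ be a cograph and let $\sigma:V\to S$ be an hc-coloring of $G$. Then $|S|=\chi(G)$.
   Context: All graphs are finite, simple and undirected. A (proper vertex) coloring of $G=(V,E)$ is a surjective map $\sigma:V\to S$ such that $xy\in E$ implies $\sigma(x)\neq\sigma(y)$; $\chi(G)$ is the chromatic number. A cograph is a graph that is $K_1$, or a disjoint union of cographs, or a join of cographs. A cotree $(T,t)$ of a cograph $G$ is a rooted tree $T$ whose leaf set is $V$, together with a labeling $t:V^0(T)\to\{0,1\}$ of its inner vertices, such that for every inner vertex $u$ the induced subgraph $G(u):=G[L(T(u))]$ (where $L(T(u))$ is the set of leaves descending from $u$) is the disjoint union (if $t(u)=0$) or the join (if $t(u)=1$) of the graphs $G(v)$, $v$ a child of $u$. The cotree is binary if every inner vertex has exactly two children. A coloring $\sigma$ of $G$ is an hc-coloring with respect to a binary cotree $(T,t)$ if for every inner vertex $u$ of $T$ with children $v_1,v_2$: if $t(u)=1$ then $\sigma(L(T(v_1)))\cap\sigma(L(T(v_2)))=\emptyset$, and if $t(u)=0$ then $\sigma(L(T(v_1)))\cap\sigma(L(T(v_2)))\in\{\sigma(L(T(v_1))),\sigma(L(T(v_2)))\}$ (i.e., one of the two color sets contains the other). A coloring $\sigma$ of a cograph $G$ is an hc-coloring of $G$ if there exists a binary cotree $(T,t)$ of $G$ such that $\sigma$ is an hc-coloring with respect to $(T,t)$. -}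

module Defs where

open import Data.Empty using (⊥)
open import Data.Fin.Base using (Fin)
open import Data.Fin.Properties using (+↔⊎; 1↔⊤)
open import Data.List.Base using (List; [_]; _++_)
open import Data.List.Membership.Propositional using () renaming (_∈_ to _∈ˡ_)
open import Data.List.Relation.Unary.Unique.Propositional using (Unique)
open import Data.Nat.Base using (ℕ; _+_; _≤_)
open import Data.Product.Base using (_×_; _,_; ∃; ∃-syntax)
open import Data.Sum.Base using (_⊎_; inj₁; inj₂)
open import Data.Sum.Function.Propositional using (_⊎-↔_)
open import Data.Unit.Base using (⊤; tt)
open import Function.Bundles using (_↔_; _⇔_; Inverse)
open import Function.Construct.Composition using (_↔-∘_)
open import Function.Construct.Symmetry using (↔-sym)
open import Function.Definitions using (Surjective)
open import Level using (0ℓ)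
open import Relation.Binary.Definitions using (Decidable; Irreflexive; Symmetric)
open import Relation.Binary.PropositionalEquality using (_≡_; _≢_; refl)
open import Relation.Nullary using (¬_; yes; no)
open import Relation.Unary using (Pred; _∩_; _∪_; _≐_; Empty)

HasCardinality : Set → ℕ → Set
HasCardinality A n = A ↔ Fin n

record Graph : Set₁ where
  field
    V      : Set
    E      : V → V → Set
    sym    : Symmetric E
    irrefl : Irreflexive _≡_ E
    E?     : Decidable E
    finite : ∃[ n ] HasCardinality V n

open Graph using (V; E)

record _≅_ (G H : Graph) : Set where
  field
    bijection : V G ↔ V H
  open Inverse bijection using (to)
  field
    preserves : ∀ x y → E G x y ⇔ E H (to x) (to y)

K₁ : Graph
K₁ = record
  { V      = ⊤
  ; E      = λ _ _ → ⊥
  ; sym    = λ ()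
  ; irrefl = λ _ ()
  ; E?     = λ _ _ → no λ ()
  ; finite = 1 , ↔-sym 1↔⊤
  }

⊎-finite : ∀ {A B} → ∃ (HasCardinality A) → ∃ (HasCardinality B) →
           ∃ (HasCardinality (A ⊎ B))
⊎-finite (m , f) (n , g) = m + n , (↔-sym +↔⊎ ↔-∘ (f ⊎-↔ g))

_∪ᵍ_ : Graph → Graph → Graph
G ∪ᵍ H = record
  { V      = V G ⊎ V H
  ; E      = adj
  ; sym    = λ {x} {y} → adj-sym x y
  ; irrefl = λ { {x} refl → adj-irrefl x }
  ; E?     = adj?
  ; finite = ⊎-finite (Graph.finite G) (Graph.finite H)
  }
  where
  adj : V G ⊎ V H → V G ⊎ V H → Set
  adj (inj₁ x) (inj₁ y) = E G x y
  adj (inj₁ x) (inj₂ y) = ⊥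
  adj (inj₂ x) (inj₁ y) = ⊥
  adj (inj₂ x) (inj₂ y) = E H x y

  adj-sym : ∀ x y → adj x y → adj y x
  adj-sym (inj₁ x) (inj₁ y) e = Graph.sym G e
  adj-sym (inj₂ x) (inj₂ y) e = Graph.sym H e

  adj-irrefl : ∀ x → ¬ adj x x
  adj-irrefl (inj₁ x) e = Graph.irrefl G refl e
  adj-irrefl (inj₂ x) e = Graph.irrefl H refl e

  adj? : Decidable adj
  adj? (inj₁ x) (inj₁ y) = Graph.E? G x y
  adj? (inj₁ x) (inj₂ y) = no λ ()
  adj? (inj₂ x) (inj₁ y) = no λ ()
  adj? (inj₂ x) (inj₂ y) = Graph.E? H x y

_⋈ᵍ_ : Graph → Graph → Graph
G ⋈ᵍ H = record
  { V      = V G ⊎ V H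
  ; E      = adj
  ; sym    = λ {x} {y} → adj-sym x y
  ; irrefl = λ { {x} refl → adj-irrefl x }
  ; E?     = adj?
  ; finite = ⊎-finite (Graph.finite G) (Graph.finite H)
  }
  where
  adj : V G ⊎ V H → V G ⊎ V H → Set
  adj (inj₁ x) (inj₁ y) = E G x y
  adj (inj₁ x) (inj₂ y) = ⊤
  adj (inj₂ x) (inj₁ y) = ⊤
  adj (inj₂ x) (inj₂ y) = E H x y

  adj-sym : ∀ x y → adj x y → adj y x
  adj-sym (inj₁ x) (inj₁ y) e = Graph.sym G e
  adj-sym (inj₁ x) (inj₂ y) _ = tt
  adj-sym (inj₂ x) (inj₁ y) _ = tt
  adj-sym (inj₂ x) (inj₂ y) e = Graph.sym H e

  adj-irrefl : ∀ x → ¬ adj x x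
  adj-irrefl (inj₁ x) e = Graph.irrefl G refl e
  adj-irrefl (inj₂ x) e = Graph.irrefl H refl e

  adj? : Decidable adj
  adj? (inj₁ x) (inj₁ y) = Graph.E? G x y
  adj? (inj₁ x) (inj₂ y) = yes tt
  adj? (inj₂ x) (inj₁ y) = yes tt
  adj? (inj₂ x) (inj₂ y) = Graph.E? H x y

-- Unions and joins of more than two cographs arise by iterating the binary
-- operations.
data IsCograph (G : Graph) : Set₁ where
  single : G ≅ K₁ → IsCograph G
  union  : ∀ {H₁ H₂} → IsCograph H₁ → IsCograph H₂ → G ≅ (H₁ ∪ᵍ H₂) → IsCograph G
  join   : ∀ {H₁ H₂} → IsCograph H₁ → IsCograph H₂ → G ≅ (H₁ ⋈ᵍ H₂) → IsCograph G

record Coloring (G : Graph) (S : Set) : Set where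
  field
    color      : V G → S
    surjective : Surjective _≡_ _≡_ color
    proper     : ∀ {x y} → E G x y → color x ≢ color y

open Coloring using (color)

-- Colorings are surjective, so a Coloring G (Fin k) uses exactly k colors.
IsChromaticNumber : Graph → ℕ → Set
IsChromaticNumber G k = Coloring G (Fin k) × (∀ m → Coloring G (Fin m) → k ≤ m)

data Label : Set where
  0ˡ 1ˡ : Label

data BinTree (A : Set) : Set where
  leaf : A → BinTree A
  node : Label → BinTree A → BinTree A → BinTree A

leaves : ∀ {A} → BinTree A → List A
leaves (leaf x)     = [ x ]
leaves (node _ l r) = leaves l ++ leaves r

L : ∀ {A} → BinTree A → Pred A 0ℓ
L T x = x ∈ˡ leaves T

-- The inner vertex at the root of node t T₁ T₂ has label t, and its children
-- are the roots of T₁ and T₂.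
data AllInner {A : Set} (P : Label → BinTree A → BinTree A → Set) : BinTree A → Set where
  leaf : ∀ {x} → AllInner P (leaf x)
  node : ∀ {t T₁ T₂} → P t T₁ T₂ → AllInner P T₁ → AllInner P T₂ →
         AllInner P (node t T₁ T₂)

-- G[W] is the disjoint union (resp. join) of G[A] and G[B].  As all three are
-- induced subgraphs of G, only the edges between A and B need a condition.
record IsDisjointUnion (G : Graph) (W A B : Pred (V G) 0ℓ) : Set where
  field
    covers   : W ≐ (A ∪ B)
    disjoint : Empty (A ∩ B)
    between  : ∀ {x y} → A x → B y → ¬ E G x y

record IsJoin (G : Graph) (W A B : Pred (V G) 0ℓ) : Set where
  field
    covers   : W ≐ (A ∪ B)
    disjoint : Empty (A ∩ B)
    between  : ∀ {x y} → A x → B y → E G x y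

CotreeAt : (G : Graph) → Label → BinTree (V G) → BinTree (V G) → Set
CotreeAt G 0ˡ T₁ T₂ = IsDisjointUnion G (L (node 0ˡ T₁ T₂)) (L T₁) (L T₂)
CotreeAt G 1ˡ T₁ T₂ = IsJoin G (L (node 1ˡ T₁ T₂)) (L T₁) (L T₂)

record IsBinaryCotree (G : Graph) (T : BinTree (V G)) : Set where
  field
    leaves-unique : Unique (leaves T)
    leaves-all    : ∀ x → L T x
    inner         : AllInner (CotreeAt G) T

Image : ∀ {A B : Set} → (A → B) → Pred A 0ℓ → Pred B 0ℓ
Image f P y = ∃[ x ] (P x × f x ≡ y)

HCAt : ∀ {A S : Set} → (A → S) → Label → BinTree A → BinTree A → Set
HCAt σ 1ˡ T₁ T₂ = Empty (Image σ (L T₁) ∩ Image σ (L T₂))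
HCAt σ 0ˡ T₁ T₂ =
  ((Image σ (L T₁) ∩ Image σ (L T₂)) ≐ Image σ (L T₁)) ⊎
  ((Image σ (L T₁) ∩ Image σ (L T₂)) ≐ Image σ (L T₂))

IsHCColoring : ∀ {G S} → Coloring G S → Set
IsHCColoring {G} σ =
  ∃[ T ] (IsBinaryCotree G T × AllInner (HCAt (color σ)) T)

{-# OPTIONS --safe #-}

-- An hc-coloured binary cotree contains a clique that meets every colour
-- occurring in the graph: at a join take the union of the cliques of the two
-- children, at a disjoint union the clique of the child with the larger colour
-- set.  Vertices of this clique with different σ-colours are adjacent, so any
-- other colouring separates them and uses at least as many colours as σ.
module Submission where

open import Defs
open import Data.Fin.Base using (Fin)
open import Data.Fin.Properties using (_≟_; injective⇒≤)
open import Data.List.Relation.Unary.Any using (here)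
open import Data.Nat.Base using (ℕ; _≤_)
open import Data.Product.Base using (_×_; _,_; ∃-syntax; proj₁; proj₂)
open import Data.Sum.Base using (inj₁; inj₂)
open import Function.Base using (_∘_)
open import Function.Bundles using (Bijection; Inverse)
open import Function.Construct.Composition using (surjective)
open import Function.Properties.Inverse using (Inverse⇒Bijection)
open import Level using (0ℓ)
open import Relation.Binary.PropositionalEquality using (_≡_; _≢_; refl; sym; trans; cong)
open import Relation.Nullary using (contradiction; yes; no)
open import Relation.Unary using (Pred; _⊆_; _∪_)

open Graph using (V; E)
open Coloring using (color)

IsClique : (G : Graph) → Pred (V G) 0ℓ → Set
IsClique G C = ∀ {x y} → C x → C y → x ≢ y → E G x y

∪-isClique : ∀ G {A B} → IsClique G A → IsClique G B →
             (∀ {x y} → A x → B y → E G x y) → IsClique G (A ∪ B)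
∪-isClique G p q r (inj₁ a) (inj₁ b) x≢y = p a b x≢y
∪-isClique G p q r (inj₁ a) (inj₂ b) x≢y = r a b
∪-isClique G p q r (inj₂ a) (inj₁ b) x≢y = Graph.sym G (r b a)
∪-isClique G p q r (inj₂ a) (inj₂ b) x≢y = q a b x≢y

-- One inclusion of images is enough, since `C ⊆ W` gives the other. Keeping `C` inside `W` is what
-- makes cliques of two joined parts completely adjacent.
FullCliqueIn : ∀ (G : Graph) {S : Set} → (V G → S) → Pred (V G) 0ℓ → Set₁
FullCliqueIn G σ W =
  ∃[ C ] (C ⊆ W × IsClique G C × Image σ W ⊆ Image σ C)

module _ (G : Graph) {S : Set} (σ : V G → S) where

  join-fullClique : ∀ {W A B} → IsJoin G W A B →
                    FullCliqueIn G σ A → FullCliqueIn G σ B → FullCliqueIn G σ W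
  join-fullClique {W} j (C , C⊆A , cl₁ , f₁) (D , D⊆B , cl₂ , f₂) =
    C ∪ D , C∪D⊆W , ∪-isClique G cl₁ cl₂ (λ c d → between (C⊆A c) (D⊆B d)) , full
    where
    open IsJoin j
    C∪D⊆W : C ∪ D ⊆ W
    C∪D⊆W (inj₁ c) = proj₂ covers (inj₁ (C⊆A c))
    C∪D⊆W (inj₂ d) = proj₂ covers (inj₂ (D⊆B d))
    full : Image σ W ⊆ Image σ (C ∪ D)
    full (x , w , eq) with proj₁ covers w
    ... | inj₁ a = let y , c , e = f₁ (x , a , eq) in y , inj₁ c , e
    ... | inj₂ b = let y , d , e = f₂ (x , b , eq) in y , inj₂ d , e

  -- Serves the disjoint union: if `A` is the part with the larger colour set, its clique already
  -- meets every colour of `W`.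
  fullClique-mono : ∀ {W A} → A ⊆ W → Image σ W ⊆ Image σ A →
                    FullCliqueIn G σ A → FullCliqueIn G σ W
  fullClique-mono A⊆W W⊆A (C , C⊆A , cl , f) = C , A⊆W ∘ C⊆A , cl , f ∘ W⊆A

  fullClique : ∀ {T} → AllInner (CotreeAt G) T → AllInner (HCAt σ) T →
               FullCliqueIn G σ (L T)
  fullClique {leaf x} leaf leaf =
    L (leaf x) , (λ p → p) ,
    (λ { (here refl) (here refl) x≢x → contradiction refl x≢x }) , (λ p → p)
  fullClique {node 1ˡ T₁ T₂} (node j c₁ c₂) (node _ h₁ h₂) =
    join-fullClique j (fullClique c₁ h₁) (fullClique c₂ h₂)
  -- The intersection equals the first colour set, so the second child has the larger one and
  -- supplies the clique.
  fullClique {node 0ˡ T₁ T₂} (node u c₁ c₂) (node (inj₁ (_ , σ₁⊆σ₁∩σ₂)) h₁ h₂) =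
    fullClique-mono (proj₂ covers ∘ inj₂) absorb (fullClique c₂ h₂)
    where
    open IsDisjointUnion u
    absorb : Image σ (L (node 0ˡ T₁ T₂)) ⊆ Image σ (L T₂)
    absorb (x , w , eq) with proj₁ covers w
    ... | inj₁ a = proj₂ (σ₁⊆σ₁∩σ₂ (x , a , eq))
    ... | inj₂ b = x , b , eq
  fullClique {node 0ˡ T₁ T₂} (node u c₁ c₂) (node (inj₂ (_ , σ₂⊆σ₁∩σ₂)) h₁ h₂) =
    fullClique-mono (proj₂ covers ∘ inj₁) absorb (fullClique c₁ h₁)
    where
    open IsDisjointUnion u
    absorb : Image σ (L (node 0ˡ T₁ T₂)) ⊆ Image σ (L T₁)
    absorb (x , w , eq) with proj₁ covers w
    ... | inj₁ a = x , a , eq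
    ... | inj₂ b = proj₁ (σ₂⊆σ₁∩σ₂ (x , b , eq))

relabel : ∀ {G S k} → HasCardinality S k → Coloring G S → Coloring G (Fin k)
relabel S↔Fin σ = record
  { color      = to ∘ color σ
  ; surjective = surjective _≡_ _≡_ _≡_ (Coloring.surjective σ)
                   (Bijection.surjective (Inverse⇒Bijection S↔Fin))
  ; proper     = λ e → Coloring.proper σ e ∘ Bijection.injective (Inverse⇒Bijection S↔Fin)
  }
  where open Inverse S↔Fin using (to)

-- Instead of counting `C`, one vertex of it is chosen for each colour of `σ`. Following this choice
-- by `τ` gives an injection from `Fin k` to `Fin m`.
clique-bound : ∀ {G k m} {C : Pred (V G) 0ℓ} (σ : V G → Fin k) → IsClique G C →
               (∀ i → Image σ C i) → Coloring G (Fin m) → k ≤ m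
clique-bound {G} {k} {m} σ cl onto τ = injective⇒≤ {f = color τ ∘ vertex} injective
  where
  vertex : Fin k → V G
  vertex i = proj₁ (onto i)
  σ-vertex : ∀ i → σ (vertex i) ≡ i
  σ-vertex i = proj₂ (proj₂ (onto i))
  injective : ∀ {i j} → color τ (vertex i) ≡ color τ (vertex j) → i ≡ j
  injective {i} {j} eq with i ≟ j
  ... | yes i≡j = i≡j
  -- Applying `σ` recovers the index of a chosen vertex, so distinct indices give distinct vertices
  -- of the clique, which are adjacent.
  ... | no  i≢j = contradiction eq (Coloring.proper τ
        (cl (proj₁ (proj₂ (onto i))) (proj₁ (proj₂ (onto j)))
          λ v≡w → i≢j (trans (sym (σ-vertex i)) (trans (cong σ v≡w) (σ-vertex j)))))

theorem3 : (G : Graph) → IsCograph G →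
    (S : Set) (k : ℕ) → HasCardinality S k →
    (σ : Coloring G S) → IsHCColoring σ →
    IsChromaticNumber G k
theorem3 G _ S k S↔Fin σ (T , cotree , hc)
  with C , _ , cl , full ← fullClique G (color σ) (IsBinaryCotree.inner cotree) hc
  = σ′ , λ m → clique-bound (color σ′) cl onto
  where
  σ′ : Coloring G (Fin k)
  σ′ = relabel S↔Fin σ
  open Inverse S↔Fin using (to)
  onto : ∀ i → Image (color σ′) C i
  onto i =
    -- The vertex `x` of colour `i` may lie outside `C`; as a leaf of `T` it can be exchanged for
    -- some `y` in `C` of the same `σ`-colour, and `to` carries this equality over to `σ′`.
    let x , hit = Coloring.surjective σ′ i
        y , c , e = full (x , IsBinaryCotree.leaves-all cotree x , refl)
    in y , c , trans (cong to e) (hit refl)
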